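{- The relation $G<_e H$ does not necessarily imply $G<_s H$, and the relation $G<_s H$ does not necessarily imply $G<_e H$. That is: (1) there exist $n$ and connected graphs $G,H$ on $n$ vertices with $G<_e H$ but not $G<_s H$; and (2) there exist $n$ and connected graphs $G,H$ on $n$ vertices with $G<_s H$ but not $G<_e H$.
   Context: All graphs are finite and simple. The chromatic symmetric function of a graph $G$ with vertices $v_1,\dots,v_n$ is $X_G=\sum_{\kappa}x_{\kappa(v_1)}\cdots x_{\kappa(v_n)}$, summed over all proper colorings $\kappa:V(G)\to\{1,2,3,\dots\}$; it is a homogeneous symmetric function of degree $n$ over $\mathbb{Q}$. Let $e_\lambda=e_{\lambda_1}e_{\lambda_2}\cdots$ be the elementary symmetric functions and $s_\lambda$ the Schur symmetric functions, two bases of the algebra of symmetric functions; $[e_\lambda]F$ and $[s_\lambda]F$ denote the coefficients of $F$ in these bases, and $F$ is $e$-positive (respectively Schur-positive) if all $[e_\lambda]F\ge0$ (respectively all $[s_\lambda]F\ge 0$). For connected graphs $G,H$ on $n$ vertices (for which the coefficients of $e_{(n)}$ and $s_{(1^n)}$ in $X_G$, $X_H$ are positive), set $$X_e(G,H)=X_G-\frac{[e_{(n)}]X_G}{[e_{(n)}]X_H}X_H,\qquad X_s(G,H)=X_G-\frac{[s_{(1^n)}]X_G}{[s_{(1^n)}]X_H}X_H.$$ Write $G\geq_e H$ (equivalently $H\le_e G$) if $X_e(G,H)$ is $e$-positive, and $G\geq_s H$ (equivalently $H\le_s G$) if $X_s(G,H)$ is Schur-positive. Strict relations $<_e$, $<_s$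 mean that the weak relation holds and $X_G\neq X_H$. -}

module Defs where

open import Data.Bool using (if_then_else_)
open import Data.Fin using (Fin)
import Data.Fin as Fin
import Data.Fin.Properties as Fin
open import Data.Integer using (+_)
open import Data.List using (List; []; _∷_; map; concat; concatMap; filter; length; foldr; tabulate; upTo; allFin; replicate; cartesianProductWith)
open import Data.List.Membership.Propositional using (_∈_)
import Data.List.Properties as List
open import Data.List.Relation.Binary.Prefix.Heterogeneous using (Prefix)
open import Data.List.Relation.Binary.Prefix.Heterogeneous.Properties using (prefix?)
open import Data.List.Relation.Unary.All using (All; all?)
open import Data.List.Relation.Unary.Linked using (Linked; linked?)
open import Data.Nat using (ℕ; zero; suc; _∸_; _≥_)
open import Data.Nat.ListAction using (sum)
import Data.Nat as ℕ
import Data.Nat.Properties as ℕ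
open import Data.Product using (∃; ∃₂; Σ-syntax; _×_; _,_)
open import Data.Rational using (ℚ; 0ℚ; 1ℚ; _+_; _-_; _*_; _÷_; _≤_; _/_; NonZero)
open import Data.Vec using (Vec; []; _∷_; lookup; toList)
open import Level using (0ℓ)
open import Relation.Binary using (Rel; Decidable; Symmetric; Irreflexive)
open import Relation.Binary.Construct.Closure.ReflexiveTransitive using (Star)
open import Relation.Binary.PropositionalEquality using (_≡_; _≢_)
open import Relation.Nullary using (Dec; ¬_; ¬?; does; _×-dec_; _→-dec_)

record Graph (n : ℕ) : Set₁ where
  field
    Adj    : Rel (Fin n) 0ℓ
    adj?   : Decidable Adj
    symm   : Symmetric Adj
    irrefl : Irreflexive _≡_ Adj

open Graph public

Connected : ∀ {n} → Graph n → Set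
Connected {n} G = ℕ.NonZero n × (∀ u v → Star (Adj G) u v)

-- The list α₁ ∷ … ∷ αₖ ∷ [] stands for the monomial x₁^α₁ ⋯ xₖ^αₖ in the
-- infinitely many variables x₁, x₂, … (so α and α followed by zeros denote the
-- same monomial), and a formal power series is its function of coefficients.

Monomial : Set
Monomial = List ℕ

Series : Set
Series = Monomial → ℚ

infix 4 _≈_

_≈_ : Series → Series → Set
F ≈ F′ = ∀ α → F α ≡ F′ α

∑[_]_ : {A : Set} → List A → (A → ℚ) → ℚ
∑[ xs ] f = foldr _+_ 0ℚ (map f xs)

-- All pairs (β , γ) of monomials with product α.
splits : Monomial → List (Monomial × Monomial)
splits []      = ([] , []) ∷ []
splits (a ∷ α) =
  cartesianProductWith (λ i (β , γ) → i ∷ β , (a ∸ i) ∷ γ) (upTo (suc a)) (splits α)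

infixl 7 _⊛_ _·_
infixl 6 _⊖_

_⊛_ : Series → Series → Series
(F ⊛ F′) α = ∑[ splits α ] λ (β , γ) → F β * F′ γ

_·_ : ℚ → Series → Series
(q · F) α = q * F α

_⊖_ : Series → Series → Series
(F ⊖ F′) α = F α - F′ α

indicator : {P : Set} → Dec P → ℚ
indicator P? = if does P? then 1ℚ else 0ℚ

words : ∀ k n → List (Vec (Fin k) n)
words k zero    = [] ∷ []
words k (suc n) = cartesianProductWith _∷_ (allFin k) (words k n)

-- The exponents of the monomial ∏ x_w over the letters w of a word.
content : ∀ {k} → List (Fin k) → Monomial
content w = tabulate λ i → length (filter (Fin._≟ i) w)

HasContent : (α : Monomial) → List (Fin (length α)) → Set
HasContent α w = content w ≡ α

hasContent? : (α : Monomial) (w : List (Fin (length α))) → Dec (HasContent α w)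
hasContent? α w = List.≡-dec ℕ._≟_ (content w) α

Proper : ∀ {n k} → Graph n → Vec (Fin k) n → Set
Proper G κ = ∀ u v → Adj G u v → lookup κ u ≢ lookup κ v

proper? : ∀ {n k} (G : Graph n) (κ : Vec (Fin k) n) → Dec (Proper G κ)
proper? G κ =
  Fin.all? λ u → Fin.all? λ v → adj? G u v →-dec ¬? (lookup κ u Fin.≟ lookup κ v)

-- The coefficient of x^α counts the proper colorings κ with x_κ(v₁) ⋯ x_κ(vₙ) = x^α;
-- such κ only use the colors 1, …, length α.
X : ∀ {n} → Graph n → Series
X {n} G α = + length (filter good? (words (length α) n)) / 1
  where good? = λ κ → proper? G κ ×-dec hasContent? α (toList κ)

eₖ : ℕ → Series
eₖ k α = indicator (all? (ℕ._≤? 1) α ×-dec (sum α ℕ.≟ k))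

e : List ℕ → Series
e []       α = indicator (sum α ℕ.≟ 0)
e (k ∷ λs) = eₖ k ⊛ e λs

-- A tableau is its list of rows, from top to bottom.  The Prefix condition says that
-- a row is no longer than the row above it and strictly larger entry by entry.
Semistandard : ∀ {k} → List (List (Fin k)) → Set
Semistandard T =
  All (Linked Fin._≤_) T ×
  Linked (λ upper lower → Prefix Fin._>_ lower upper) T

semistandard? : ∀ {k} (T : List (List (Fin k))) → Dec (Semistandard T)
semistandard? T =
  all? (linked? Fin._≤?_) T ×-dec
  linked? (λ upper lower → prefix? (λ x y → y Fin.<? x) lower upper) T

fillings : ∀ k → List ℕ → List (List (List (Fin k)))
fillings k []       = [] ∷ []
fillings k (r ∷ λs) = cartesianProductWith (λ w T → toList w ∷ T) (words k r) (fillings k λs)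

s : List ℕ → Series
s λs α = + length (filter good? (fillings (length α) λs)) / 1
  where good? = λ T → semistandard? T ×-dec hasContent? α (concat T)

compositions : ℕ → List (List ℕ)
compositions zero    = [] ∷ []
compositions (suc n) = concatMap extend (compositions n)
  where
  extend : List ℕ → List (List ℕ)
  extend []       = (1 ∷ []) ∷ []
  extend (k ∷ ks) = (1 ∷ k ∷ ks) ∷ (suc k ∷ ks) ∷ []

partitions : ℕ → List (List ℕ)
partitions n = filter (linked? ℕ._≥?_) (compositions n)

Family : Set
Family = List ℕ → Series

-- F = ∑ c(λ) b_λ over the partitions λ of n.  For b = e or b = s such a c exists, and is
-- unique on the partitions of n, for every homogeneous symmetric F of degree n, as b is
-- then a basis; coefficients in the basis are therefore given as a relation.
Expansion : Family → ℕ → Series → (List ℕ → ℚ) → Set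
Expansion b n F c = F ≈ λ α → ∑[ partitions n ] λ p → c p * b p α

-- [b_p] F = q, for F homogeneous of degree n.
Coefficient : Family → ℕ → List ℕ → Series → ℚ → Set
Coefficient b n p F q = p ∈ partitions n × (∃ λ c → Expansion b n F c × c p ≡ q)

Positive : Family → ℕ → Series → Set
Positive b n F = ∃ λ c → Expansion b n F c × All (λ p → 0ℚ ≤ c p) (partitions n)

-- X_G − ([b_p]X_G / [b_p]X_H) X_H is b-positive.
Dominates : Family → List ℕ → ∀ {n} → Graph n → Graph n → Set
Dominates b p {n} G H =
  ∃₂ λ x y → Coefficient b n p (X G) x × Coefficient b n p (X H) y ×
  (Σ[ y≢0 ∈ NonZero y ] Positive b n (X G ⊖ (_÷_ x y {{y≢0}}) · X H))

infix 4 _≥ₑ_ _≥ₛ_ _<ₑ_ _<ₛ_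

_≥ₑ_ _≥ₛ_ _<ₑ_ _<ₛ_ : ∀ {n} → Graph n → Graph n → Set
_≥ₑ_ {n} = Dominates e (n ∷ [])
_≥ₛ_ {n} = Dominates s (replicate n 1)
G <ₑ H = H ≥ₑ G × ¬ (X G ≈ X H)
G <ₛ H = H ≥ₛ G × ¬ (X G ≈ X H)

-- The house H and the bowtie B (two triangles sharing a vertex) satisfy
--   X_H = 30 e₅ + 6 e₄₁ + 6 e₃₂ = 6 s₂₂₁ + 12 s₂₁₁₁ + 42 s₁₁₁₁₁,
--   X_B = 20 e₅ + 12 e₄₁ + 4 e₃₂ = 4 s₂₂₁ + 16 s₂₁₁₁ + 36 s₁₁₁₁₁,
-- so H <ₑ B but not H <ₛ B.  The diamond D and the 4-cycle C satisfy
--   X_D = 16 e₄ + 2 e₃₁ = 2 s₂₁₁ + 18 s₁₁₁₁,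
--   X_C = 12 e₄ + 2 e₂₂ = 2 s₂₂ + 2 s₂₁₁ + 14 s₁₁₁₁,
-- so D <ₛ C but not D <ₑ C.
-- An identity between homogeneous series of degree n has to hold at every monomial, but
-- all series involved are quasisymmetric: the coefficient at α only depends on the positive
-- entries of α.  So it is enough to compare them at the compositions of n.  The
-- coefficient of b_q is read off a series of degree n by a linear functional that sends
-- b_q to 1 and every other b_p to 0; this refutes domination.

module Submission where

open import Defs
open import Data.Bool using (Bool; true; false; T; _∧_; if_then_else_)
open import Data.Bool.Properties using (T?)
open import Data.Fin using (Fin; zero; suc; inject₁)
import Data.Fin as Fin
import Data.Fin.Induction as Fin
import Data.Fin.Properties as Fin
open import Data.Integer using (+_)
open import Data.List using (List; []; _∷_; _++_; map; concat; filter; length; tabulate; upTo; cartesianProductWith; lookup)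
open import Data.List.Membership.Propositional using (_∈_; _∉_; find)
import Data.List.Membership.DecPropositional as DecMembership
import Data.List.Membership.Propositional.Properties as ∈
open import Data.List.Membership.Propositional.Properties.WithK using (unique∧set⇒bag)
import Data.List.Properties as List
open import Data.List.Relation.Binary.BagAndSetEquality using (∼bag⇒↭)
open import Data.List.Relation.Binary.Permutation.Propositional.Properties using (↭-length)
open import Data.List.Relation.Binary.Pointwise as Pointwise using (Pointwise; []; _∷_)
import Data.List.Relation.Binary.Prefix.Heterogeneous as Prefix
import Data.List.Relation.Binary.Prefix.Heterogeneous.Properties as Prefix
open import Data.List.Relation.Unary.All as All using (All; []; _∷_; all?)
import Data.List.Relation.Unary.All.Properties as All
open import Data.List.Relation.Unary.AllPairs using ([]; _∷_)
open import Data.List.Relation.Unary.Any as Any using (here; there)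
import Data.List.Relation.Unary.Linked as Linked
import Data.List.Relation.Unary.Linked.Properties as Linked
open import Data.List.Relation.Unary.Unique.Propositional using (Unique)
import Data.List.Relation.Unary.Unique.DecPropositional as DecUnique
import Data.List.Relation.Unary.Unique.Propositional.Properties as Unique
open import Data.Nat using (ℕ; zero; suc; s≤s; z≤n)
open import Data.Nat.ListAction using (sum)
import Data.Nat as ℕ
import Data.Nat.Properties as ℕ
import Data.Nat.Solver as ℕ
open import Data.Product using (∃; Σ-syntax; _×_; _,_; proj₁; proj₂)
open import Data.Rational using (ℚ; 0ℚ; 1ℚ; _+_; _-_; _*_; _÷_; -_; _≤_; _/_; NonZero)
import Data.Rational as ℚ
import Data.Rational.Properties as ℚ
import Data.Rational.Solver as ℚ
open import Data.Sum using (_⊎_; inj₁; inj₂)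
open import Data.Vec as Vec using (Vec; []; _∷_; toList)
import Data.Vec.Properties as Vec
open import Function using (_∘_; mk⇔)
open import Level using (0ℓ)
open import Relation.Binary.Construct.Closure.ReflexiveTransitive as Star using (Star; ε; _◅_; _◅◅_)
open import Relation.Binary.PropositionalEquality using (_≡_; _≢_; refl; sym; trans; cong; cong₂; subst; module ≡-Reasoning)
open import Relation.Nullary using (Dec; yes; no; does; ¬_; contradiction; True; toWitness; from-yes; from-no; ¬?; _→-dec_; _×-dec_)
open import Relation.Unary using (Pred; Decidable)

-- Sums

private variable
  A B : Set

∑-cong-All : ∀ {f g : A → ℚ} {xs} → All (λ x → f x ≡ g x) xs → ∑[ xs ] f ≡ ∑[ xs ] g
∑-cong-All []         = refl
∑-cong-All (eq ∷ eqs) = cong₂ _+_ eq (∑-cong-All eqs)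

∑-cong : ∀ {f g : A → ℚ} xs → (∀ x → f x ≡ g x) → ∑[ xs ] f ≡ ∑[ xs ] g
∑-cong xs eq = ∑-cong-All (All.universal eq xs)

∑-zero : ∀ {f : A → ℚ} {xs} → All (λ x → f x ≡ 0ℚ) xs → ∑[ xs ] f ≡ 0ℚ
∑-zero []         = refl
∑-zero (eq ∷ eqs) = cong₂ _+_ eq (∑-zero eqs)

∑-pointwise : ∀ {R : A → B → Set} {f : A → ℚ} {g : B → ℚ} {xs ys} →
              (∀ {x y} → R x y → f x ≡ g y) → Pointwise R xs ys → ∑[ xs ] f ≡ ∑[ ys ] g
∑-pointwise eq []       = refl
∑-pointwise eq (r ∷ rs) = cong₂ _+_ (eq r) (∑-pointwise eq rs)

∑-distribˡ : ∀ q (f : A → ℚ) xs → q * ∑[ xs ] f ≡ ∑[ xs ] λ x → q * f x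
∑-distribˡ q f []       = ℚ.*-zeroʳ q
∑-distribˡ q f (x ∷ xs) = trans (ℚ.*-distribˡ-+ q (f x) _) (cong (λ z → q * f x + z) (∑-distribˡ q f xs))

∑-+ : ∀ (f g : A → ℚ) xs → ∑[ xs ] (λ x → f x + g x) ≡ ∑[ xs ] f + ∑[ xs ] g
∑-+ f g []       = refl
∑-+ f g (x ∷ xs) = trans (cong (λ z → f x + g x + z) (∑-+ f g xs))
  (solve 4 (λ a b c d → (a :+ b) :+ (c :+ d) := (a :+ c) :+ (b :+ d)) refl (f x) (g x) _ _)
  where open ℚ.+-*-Solver

∑-linear : ∀ q (f g : A → ℚ) xs → ∑[ xs ] (λ x → f x - q * g x) ≡ ∑[ xs ] f - q * ∑[ xs ] g
∑-linear q f g []       = sym (cong (λ z → 0ℚ - z) (ℚ.*-zeroʳ q))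
∑-linear q f g (x ∷ xs) = trans (cong (λ z → f x - q * g x + z) (∑-linear q f g xs))
  (solve 5 (λ q a b c d → (a :- q :* b) :+ (c :- q :* d) := (a :+ c) :- q :* (b :+ d))
     refl q (f x) (g x) _ _)
  where open ℚ.+-*-Solver

∑-swap : ∀ (f : A → B → ℚ) xs ys →
         ∑[ xs ] (λ x → ∑[ ys ] f x) ≡ ∑[ ys ] λ y → ∑[ xs ] λ x → f x y
∑-swap f []       ys = sym (∑-zero (All.universal (λ _ → refl) ys))
∑-swap f (x ∷ xs) ys = trans (cong (λ z → ∑[ ys ] f x + z) (∑-swap f xs ys)) (sym (∑-+ (f x) (λ y → ∑[ xs ] λ x → f x y) ys))

indicator-no : ∀ {P : Set} (P? : Dec P) → ¬ P → indicator P? ≡ 0ℚ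
indicator-no (yes p) ¬p = contradiction p ¬p
indicator-no (no _)  _  = refl

indicator-yes : ∀ {P : Set} (P? : Dec P) → P → indicator P? ≡ 1ℚ
indicator-yes (yes _) _ = refl
indicator-yes (no ¬p) p = contradiction p ¬p

_≟ᵖ_ : (p q : List ℕ) → Dec (p ≡ q)
_≟ᵖ_ = List.≡-dec ℕ._≟_

-- Uniqueness of the list makes the term at `q` occur exactly once; every other term vanishes.
∑-indicator : ∀ (c : List ℕ → ℚ) {q ps} → Unique ps → q ∈ ps →
              ∑[ ps ] (λ p → c p * indicator (p ≟ᵖ q)) ≡ c q
∑-indicator c {q} {p ∷ ps} (p∉ps ∷ _) (here refl) = begin
  c q * indicator (q ≟ᵖ q) + ∑[ ps ] (λ p → c p * indicator (p ≟ᵖ q))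
    ≡⟨ cong₂ _+_ (cong (c q *_) (indicator-yes (q ≟ᵖ q) refl))
         (∑-zero (All.map (λ {r} q≢r → trans (cong (c r *_) (indicator-no (r ≟ᵖ q) (q≢r ∘ sym)))
                                             (ℚ.*-zeroʳ (c r))) p∉ps)) ⟩
  c q * 1ℚ + 0ℚ
    ≡⟨ trans (ℚ.+-identityʳ _) (ℚ.*-identityʳ _) ⟩
  c q ∎
  where open ≡-Reasoning
∑-indicator c {q} {p ∷ ps} (p∉ps ∷ ps!) (there q∈ps) = begin
  c p * indicator (p ≟ᵖ q) + ∑[ ps ] (λ p → c p * indicator (p ≟ᵖ q))
    ≡⟨ cong₂ _+_ (cong (c p *_) (indicator-no (p ≟ᵖ q) (All.lookup p∉ps q∈ps)))
                 (∑-indicator c ps! q∈ps) ⟩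
  c p * 0ℚ + c q
    ≡⟨ trans (cong (_+ c q) (ℚ.*-zeroʳ (c p))) (ℚ.+-identityˡ _) ⟩
  c q ∎
  where open ≡-Reasoning

-- Homogeneous quasisymmetric series

infix 4 _⊴_

-- `β` arises from `α` by inserting zero exponents. A derivation records the positions of the
-- insertions, from which `embed` computes the renaming of variables.
data _⊴_ : Monomial → Monomial → Set where
  done : [] ⊴ []
  keep : ∀ a {α β} → α ⊴ β → a ∷ α ⊴ a ∷ β
  skip : ∀ {α β} → α ⊴ β → α ⊴ 0 ∷ β

Quasisymmetric : Series → Set
Quasisymmetric F = ∀ {α β} → α ⊴ β → F α ≡ F β

Homogeneous : ℕ → Series → Set
Homogeneous n F = ∀ α → sum α ≢ n → F α ≡ 0ℚ

sum-⊴ : ∀ {α β} → α ⊴ β → sum α ≡ sum β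
sum-⊴ done         = refl
sum-⊴ (keep a α⊴β) = cong (a ℕ.+_) (sum-⊴ α⊴β)
sum-⊴ (skip α⊴β)   = sum-⊴ α⊴β

positives : Monomial → Monomial
positives []          = []
positives (zero ∷ α)  = positives α
positives (suc a ∷ α) = suc a ∷ positives α

positives-⊴ : ∀ α → positives α ⊴ α
positives-⊴ []          = done
positives-⊴ (zero ∷ α)  = skip (positives-⊴ α)
positives-⊴ (suc a ∷ α) = keep (suc a) (positives-⊴ α)

-- `compositions (suc n)` prepends a 1 to each composition of `n` or raises its first part, if there
-- is one. A first part `suc a` thus comes from one prepending and `a` raisings.
∷-∈-compositions : ∀ a {n α} → α ∈ compositions n → suc a ∷ α ∈ compositions (suc a ℕ.+ n)
∷-∈-compositions zero α∈ = ∈.∈-concatMap⁺ _ (Any.map (λ { {[]} refl → here refl ; {_ ∷ _} refl → here refl }) α∈)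
∷-∈-compositions (suc a) α∈ =
  ∈.∈-concatMap⁺ _ (Any.map (λ { refl → there (here refl) }) (∷-∈-compositions a α∈))

positives-∈-compositions : ∀ α → positives α ∈ compositions (sum α)
positives-∈-compositions []          = here refl
positives-∈-compositions (zero ∷ α)  = positives-∈-compositions α
positives-∈-compositions (suc a ∷ α) = ∷-∈-compositions a (positives-∈-compositions α)

sum-composition : ∀ n {α} → α ∈ compositions n → sum α ≡ n
sum-composition zero    (here refl) = refl
sum-composition (suc n) α∈ with find (∈.∈-concatMap⁻ _ {xs = compositions n} α∈)
... | []    , β∈ , here refl         = cong suc (sum-composition n β∈)
... | _ ∷ _ , β∈ , here refl         = cong suc (sum-composition n β∈)
... | _ ∷ _ , β∈ , there (here refl) = cong suc (sum-composition n β∈)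

-- Away from degree `n` both series vanish. In degree `n`, deleting the zeros of `α` changes neither
-- value and leaves a composition of `n`, so finitely many checks suffice.
≈-from-compositions : ∀ {n} F F′ → Homogeneous n F → Homogeneous n F′ →
  Quasisymmetric F → Quasisymmetric F′ → All (λ α → F α ≡ F′ α) (compositions n) → F ≈ F′
≈-from-compositions {n} F F′ F-hom F′-hom F-qs F′-qs eqs α with sum α ℕ.≟ n
... | no  ∑α≢n = trans (F-hom α ∑α≢n) (sym (F′-hom α ∑α≢n))
... | yes refl = begin
  F α              ≡⟨ F-qs (positives-⊴ α) ⟨
  F (positives α)  ≡⟨ All.lookup eqs (positives-∈-compositions α) ⟩
  F′ (positives α) ≡⟨ F′-qs (positives-⊴ α) ⟩
  F′ α             ∎
  where open ≡-Reasoning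

record GradedQuasisymmetric (b : Family) : Set where
  field
    homogeneous    : ∀ p → Homogeneous (sum p) (b p)
    quasisymmetric : ∀ p → Quasisymmetric (b p)

open GradedQuasisymmetric

-- A partition of `n` has sum `n`, so the linear combination inherits homogeneity of degree `n` and
-- quasisymmetry from the family.
expansion-from-compositions : ∀ b n F c → GradedQuasisymmetric b →
  Homogeneous n F → Quasisymmetric F →
  All (λ α → F α ≡ ∑[ partitions n ] λ p → c p * b p α) (compositions n) → Expansion b n F c
expansion-from-compositions b n F c b-gqs F-hom F-qs =
  ≈-from-compositions F (λ α → ∑[ partitions n ] λ p → c p * b p α) F-hom
    (λ α ∑α≢n → ∑-zero (All.tabulate λ {p} p∈ →
      trans (cong (c p *_) (homogeneous b-gqs p α
               (λ ∑α≡∑p → ∑α≢n (trans ∑α≡∑p (sum-composition n (proj₁ (∈.∈-filter⁻ _ {xs = compositions n} p∈)))))))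
            (ℚ.*-zeroʳ (c p))))
    F-qs
    (λ α⊴β → ∑-cong (partitions n) λ p → cong (c p *_) (quasisymmetric b-gqs p α⊴β))

-- Elementary symmetric functions

private
  Split-⊴ : Monomial × Monomial → Monomial × Monomial → Set
  Split-⊴ (β , γ) (β′ , γ′) = β ⊴ β′ × γ ⊴ γ′

-- An inserted 0 splits only as 0 + 0, so the two lists of splits have the same length and order and
-- can be compared entry by entry.
splits-⊴ : ∀ {α β} → α ⊴ β → Pointwise Split-⊴ (splits α) (splits β)
splits-⊴ done = (done , done) ∷ []
splits-⊴ (keep a α⊴β) = each (upTo (suc a)) (splits-⊴ α⊴β)
  where
  each : ∀ is {xs ys} → Pointwise Split-⊴ xs ys →
         Pointwise Split-⊴ (cartesianProductWith (λ i (β , γ) → i ∷ β , (a ℕ.∸ i) ∷ γ) is xs)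
                           (cartesianProductWith (λ i (β , γ) → i ∷ β , (a ℕ.∸ i) ∷ γ) is ys)
  each []       rs = []
  each (i ∷ is) rs = Pointwise.++⁺
    (Pointwise.map⁺ _ _ (Pointwise.map (λ (β⊴ , γ⊴) → keep _ β⊴ , keep _ γ⊴) rs)) (each is rs)
splits-⊴ (skip α⊴β) = skips (splits-⊴ α⊴β)
  where
  -- `upTo 1` has the single entry 0, so the splits of `0 ∷ β` compute to this one `map` followed by
  -- `[]`.
  skips : ∀ {xs ys} → Pointwise Split-⊴ xs ys →
          Pointwise Split-⊴ xs (map (λ (β , γ) → 0 ∷ β , 0 ∷ γ) ys ++ [])
  skips []                = []
  skips ((β⊴ , γ⊴) ∷ rs) = (skip β⊴ , skip γ⊴) ∷ skips rs

⊛-quasisymmetric : ∀ {F F′} → Quasisymmetric F → Quasisymmetric F′ → Quasisymmetric (F ⊛ F′)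
⊛-quasisymmetric F-qs F′-qs α⊴β =
  ∑-pointwise (λ (β⊴ , γ⊴) → cong₂ _*_ (F-qs β⊴) (F′-qs γ⊴)) (splits-⊴ α⊴β)

sum-splits : ∀ α → All (λ (β , γ) → sum β ℕ.+ sum γ ≡ sum α) (splits α)
sum-splits []      = refl ∷ []
sum-splits (a ∷ α) = All.tabulate λ βγ∈ → lemma (∈.∈-cartesianProductWith⁻ _ (upTo (suc a)) (splits α) βγ∈)
  where
  open ≡-Reasoning
  lemma : ∀ {βγ} → (∃ λ i → ∃ λ βγ′ → i ∈ upTo (suc a) × βγ′ ∈ splits α ×
                    βγ ≡ (i ∷ proj₁ βγ′ , (a ℕ.∸ i) ∷ proj₂ βγ′)) →
          sum (proj₁ βγ) ℕ.+ sum (proj₂ βγ) ≡ a ℕ.+ sum α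
  lemma (i , (β , γ) , i∈ , βγ∈ , refl) = begin
    (i ℕ.+ sum β) ℕ.+ ((a ℕ.∸ i) ℕ.+ sum γ)
      ≡⟨ solve 4 (λ i b j c → (i :+ b) :+ (j :+ c) := (i :+ j) :+ (b :+ c)) refl i (sum β) (a ℕ.∸ i) (sum γ) ⟩
    (i ℕ.+ (a ℕ.∸ i)) ℕ.+ (sum β ℕ.+ sum γ)
      -- `i` is drawn from `upTo (suc a)`, so it is at most `a` and the truncated subtraction is
      -- exact.
      ≡⟨ cong₂ ℕ._+_ (ℕ.m+[n∸m]≡n (ℕ.s≤s⁻¹ (∈.∈-upTo⁻ i∈))) (All.lookup (sum-splits α) βγ∈) ⟩
    a ℕ.+ sum α ∎
    where open ℕ.+-*-Solver

-- The two degrees in a split add up to `sum α`. If this is not `m + n`, one factor of each product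
-- has the wrong degree and vanishes.
⊛-homogeneous : ∀ {m n F F′} → Homogeneous m F → Homogeneous n F′ → Homogeneous (m ℕ.+ n) (F ⊛ F′)
⊛-homogeneous {m} {n} {F} {F′} F-hom F′-hom α ∑α≢m+n = ∑-zero (All.map vanish (sum-splits α))
  where
  vanish : ∀ {βγ : Monomial × Monomial} → sum (proj₁ βγ) ℕ.+ sum (proj₂ βγ) ≡ sum α →
           F (proj₁ βγ) * F′ (proj₂ βγ) ≡ 0ℚ
  vanish {β , γ} eq with sum β ℕ.≟ m
  ... | no  ∑β≢m = trans (cong (_* F′ γ) (F-hom β ∑β≢m)) (ℚ.*-zeroˡ (F′ γ))
  ... | yes refl = trans (cong (F β *_) (F′-hom γ λ { refl → ∑α≢m+n (sym eq) })) (ℚ.*-zeroʳ (F β))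

eₖ-quasisymmetric : ∀ k → Quasisymmetric (eₖ k)
eₖ-quasisymmetric k α⊴β =
  -- `indicator` sees only the `does` of a decision, so it is enough to compare booleans: an
  -- inserted 0 passes the test for `≤ 1` and adds nothing to the sum.
  cong₂ (λ b m → if b ∧ does (m ℕ.≟ k) then 1ℚ else 0ℚ) (squarefree α⊴β) (sum-⊴ α⊴β)
  where
  squarefree : ∀ {α β} → α ⊴ β → does (all? (ℕ._≤? 1) α) ≡ does (all? (ℕ._≤? 1) β)
  squarefree done         = refl
  squarefree (keep a α⊴β) = cong (does (a ℕ.≤? 1) ∧_) (squarefree α⊴β)
  squarefree (skip α⊴β)   = squarefree α⊴β

eₖ-homogeneous : ∀ k → Homogeneous k (eₖ k)
eₖ-homogeneous k α ∑α≢k = indicator-no (all? (ℕ._≤? 1) α ×-dec (sum α ℕ.≟ k)) (∑α≢k ∘ proj₂)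

e-gradedQuasisymmetric : GradedQuasisymmetric e
e-gradedQuasisymmetric .homogeneous []      α ∑α≢0 = indicator-no (sum α ℕ.≟ 0) ∑α≢0
e-gradedQuasisymmetric .homogeneous (k ∷ p) =
  ⊛-homogeneous (eₖ-homogeneous k) (e-gradedQuasisymmetric .homogeneous p)
e-gradedQuasisymmetric .quasisymmetric []      α⊴β = cong (λ m → indicator (m ℕ.≟ 0)) (sum-⊴ α⊴β)
e-gradedQuasisymmetric .quasisymmetric (k ∷ p) =
  ⊛-quasisymmetric {eₖ k} (eₖ-quasisymmetric k) (e-gradedQuasisymmetric .quasisymmetric p)

-- Counting words and tableaux with given content

count : ∀ {k} → Fin k → List (Fin k) → ℕ
count i w = length (filter (Fin._≟ i) w)

-- Models prepending a letter `x` to a word: `h` and `g` are the letter counts before and after.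
sum-tabulate-suc : ∀ {k} {g h : Fin k → ℕ} x → g x ≡ suc (h x) → (∀ i → i ≢ x → g i ≡ h i) →
                   sum (tabulate g) ≡ suc (sum (tabulate h))
sum-tabulate-suc zero eq eqs =
  cong₂ ℕ._+_ eq (cong sum (List.tabulate-cong λ i → eqs (suc i) λ ()))
sum-tabulate-suc {h = h} (suc x) eq eqs = trans
  (cong₂ ℕ._+_ (eqs zero λ ()) (sum-tabulate-suc x eq λ i i≢x → eqs (suc i) (i≢x ∘ Fin.suc-injective)))
  (ℕ.+-suc (h zero) _)

sum-content : ∀ {k} (w : List (Fin k)) → sum (content w) ≡ length w
sum-content {k} [] = sum-zeros k
  where
  sum-zeros : ∀ k → sum (tabulate {n = k} λ _ → 0) ≡ 0
  sum-zeros zero    = refl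
  sum-zeros (suc k) = sum-zeros k
sum-content (x ∷ w) = trans
  (sum-tabulate-suc x (cong length (List.filter-accept (Fin._≟ x) {xs = w} refl))
     (λ i i≢x → cong length (List.filter-reject (Fin._≟ i) {xs = w} (i≢x ∘ sym))))
  (cong suc (sum-content w))

tabulate≡⇒≗ : ∀ {α : List A} {g} → tabulate g ≡ α → ∀ i → g i ≡ lookup α i
tabulate≡⇒≗ {α = x ∷ α} eq zero    = List.∷-injectiveˡ eq
tabulate≡⇒≗ {α = x ∷ α} eq (suc i) = tabulate≡⇒≗ (List.∷-injectiveʳ eq) i

hasContent⇒count : ∀ α w → HasContent α w → ∀ i → count i w ≡ lookup α i
hasContent⇒count α w = tabulate≡⇒≗

count⇒hasContent : ∀ α w → (∀ i → count i w ≡ lookup α i) → HasContent α w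
count⇒hasContent α w eq = trans (List.tabulate-cong eq) (List.tabulate-lookup α)

module _ {k l} (f : Fin k → Fin l) (f-injective : ∀ {i j} → f i ≡ f j → i ≡ j) where

  count-map : ∀ i w → count (f i) (map f w) ≡ count i w
  count-map i []      = refl
  count-map i (x ∷ w) with x Fin.≟ i | f x Fin.≟ f i
  ... | yes _    | yes _     = cong suc (count-map i w)
  ... | no  _    | no  _     = count-map i w
  ... | yes refl | no  fx≢fi = contradiction refl fx≢fi
  ... | no  x≢i  | yes fx≡fi = contradiction (f-injective fx≡fi) x≢i

count-∉ : ∀ {k} {j : Fin k} {w} → j ∉ w → count j w ≡ 0
count-∉ {j = j} j∉w = cong length
  (List.filter-none (Fin._≟ j) (All.tabulate λ {x} x∈w x≡j → j∉w (subst (_∈ _) x≡j x∈w)))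

count≡0⇒∉ : ∀ {k} {j : Fin k} {w} → count j w ≡ 0 → j ∉ w
count≡0⇒∉ {j = j} {w} eq j∈w with filter (Fin._≟ j) w | ∈.∈-filter⁺ (Fin._≟ j) j∈w refl
count≡0⇒∉ () j∈w | _ ∷ _ | _

-- The letters of β that are not in the image are those of exponent 0.
embed : ∀ {α β} → α ⊴ β → Fin (length α) → Fin (length β)
embed (keep a α⊴β) zero    = zero
embed (keep a α⊴β) (suc i) = suc (embed α⊴β i)
embed (skip α⊴β)   i       = suc (embed α⊴β i)

-- The order is both preserved and reflected, so that semistandard tableaux can be carried in both
-- directions. The strict versions and injectivity follow because the order is total and
-- antisymmetric.
embed-mono-≤ : ∀ {α β} (α⊴β : α ⊴ β) {i j} → i Fin.≤ j → embed α⊴β i Fin.≤ embed α⊴β j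
embed-mono-≤ (keep a α⊴β) {zero}          _         = z≤n
embed-mono-≤ (keep a α⊴β) {suc i} {suc j} (s≤s i≤j) = s≤s (embed-mono-≤ α⊴β i≤j)
embed-mono-≤ (skip α⊴β)                   i≤j       = s≤s (embed-mono-≤ α⊴β i≤j)

embed-cancel-≤ : ∀ {α β} (α⊴β : α ⊴ β) {i j} → embed α⊴β i Fin.≤ embed α⊴β j → i Fin.≤ j
embed-cancel-≤ (keep a α⊴β) {zero}          _         = z≤n
embed-cancel-≤ (keep a α⊴β) {suc i} {suc j} (s≤s i≤j) = s≤s (embed-cancel-≤ α⊴β i≤j)
embed-cancel-≤ (skip α⊴β)                   (s≤s i≤j) = embed-cancel-≤ α⊴β i≤j

embed-mono-< : ∀ {α β} (α⊴β : α ⊴ β) {i j} → i Fin.< j → embed α⊴β i Fin.< embed α⊴β j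
embed-mono-< α⊴β i<j = ℕ.≰⇒> (ℕ.<⇒≱ i<j ∘ embed-cancel-≤ α⊴β)

embed-cancel-< : ∀ {α β} (α⊴β : α ⊴ β) {i j} → embed α⊴β i Fin.< embed α⊴β j → i Fin.< j
embed-cancel-< α⊴β i<j = ℕ.≰⇒> (ℕ.<⇒≱ i<j ∘ embed-mono-≤ α⊴β)

embed-injective : ∀ {α β} (α⊴β : α ⊴ β) {i j} → embed α⊴β i ≡ embed α⊴β j → i ≡ j
embed-injective α⊴β eq = Fin.≤-antisym (embed-cancel-≤ α⊴β (Fin.≤-reflexive eq))
                                       (embed-cancel-≤ α⊴β (Fin.≤-reflexive (sym eq)))

lookup-embed : ∀ {α β} (α⊴β : α ⊴ β) i → lookup β (embed α⊴β i) ≡ lookup α i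
lookup-embed (keep a α⊴β) zero    = refl
lookup-embed (keep a α⊴β) (suc i) = lookup-embed α⊴β i
lookup-embed (skip α⊴β)   i       = lookup-embed α⊴β i

embed-cover : ∀ {α β} (α⊴β : α ⊴ β) j →
              (∃ λ i → embed α⊴β i ≡ j) ⊎ ((∀ i → embed α⊴β i ≢ j) × lookup β j ≡ 0)
embed-cover (keep a α⊴β) zero = inj₁ (zero , refl)
embed-cover (keep a α⊴β) (suc j) with embed-cover α⊴β j
... | inj₁ (i , eq)  = inj₁ (suc i , cong suc eq)
... | inj₂ (≢j , eq0) = inj₂ ((λ { zero () ; (suc i) eq → ≢j i (Fin.suc-injective eq) }) , eq0)
embed-cover (skip α⊴β) zero = inj₂ ((λ _ ()) , refl)
embed-cover (skip α⊴β) (suc j) with embed-cover α⊴β j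
... | inj₁ (i , eq)  = inj₁ (i , cong suc eq)
... | inj₂ (≢j , eq0) = inj₂ ((λ i eq → ≢j i (Fin.suc-injective eq)) , eq0)

-- Injectivity keeps the count of a letter in the image. A letter outside it has count 0 and, by
-- `embed-cover`, exponent 0.
hasContent-embed⁺ : ∀ {α β} (α⊴β : α ⊴ β) w → HasContent α w → HasContent β (map (embed α⊴β) w)
hasContent-embed⁺ {α} {β} α⊴β w wα = count⇒hasContent β (map (embed α⊴β) w) counts
  where
  counts : ∀ j → count j (map (embed α⊴β) w) ≡ lookup β j
  counts j with embed-cover α⊴β j
  ... | inj₁ (i , refl) = trans (count-map (embed α⊴β) (embed-injective α⊴β) i w)
                                (trans (hasContent⇒count α w wα i) (sym (lookup-embed α⊴β i)))
  ... | inj₂ (≢j , eq0) = trans (count-∉ j∉) (sym eq0)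
    where
    j∉ : j ∉ map (embed α⊴β) w
    j∉ j∈ with i , _ , eq ← ∈.∈-map⁻ (embed α⊴β) j∈ = ≢j i (sym eq)

hasContent-embed⁻ : ∀ {α β} (α⊴β : α ⊴ β) w → HasContent β (map (embed α⊴β) w) → HasContent α w
hasContent-embed⁻ {α} {β} α⊴β w wβ = count⇒hasContent α w λ i →
  trans (sym (count-map (embed α⊴β) (embed-injective α⊴β) i w))
        (trans (hasContent⇒count β (map (embed α⊴β) w) wβ (embed α⊴β i)) (lookup-embed α⊴β i))

-- A letter outside the image has exponent 0 in `β`, hence does not occur in a word of content `β`.
-- This provides the preimages in the bijections below.
hasContent⇒embedded : ∀ {α β} (α⊴β : α ⊴ β) w → HasContent β w → All (λ j → ∃ λ i → embed α⊴β i ≡ j) w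
hasContent⇒embedded {α} {β} α⊴β w wβ = All.tabulate λ {j} j∈w → letter j j∈w (embed-cover α⊴β j)
  where
  letter : ∀ j → j ∈ w → (∃ λ i → embed α⊴β i ≡ j) ⊎ ((∀ i → embed α⊴β i ≢ j) × lookup β j ≡ 0) → ∃ λ i → embed α⊴β i ≡ j
  letter j j∈w (inj₁ i)         = i
  letter j j∈w (inj₂ (_ , eq0)) = contradiction j∈w (count≡0⇒∉ (trans (hasContent⇒count β w wβ j) eq0))

-- The image under `f` of the first filtered list and the second filtered list are duplicate-free
-- with the same elements, hence permutations of each other.
length-filter-bijection :
  ∀ {P : Pred A 0ℓ} {Q : Pred B 0ℓ} (P? : Decidable P) (Q? : Decidable Q) {xs ys} →
  Unique xs → Unique ys → (f : A → B) → (∀ {x y} → f x ≡ f y → x ≡ y) →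
  (∀ {x} → x ∈ xs → P x → f x ∈ ys × Q (f x)) →
  (∀ {y} → y ∈ ys → Q y → ∃ λ x → f x ≡ y × x ∈ xs × P x) →
  length (filter P? xs) ≡ length (filter Q? ys)
length-filter-bijection P? Q? {xs} {ys} xs! ys! f f-injective f-maps f-onto =
  trans (sym (List.length-map f (filter P? xs)))
    (↭-length (∼bag⇒↭ (unique∧set⇒bag
      (Unique.map⁺ f-injective (Unique.filter⁺ P? xs!)) (Unique.filter⁺ Q? ys!) (mk⇔ to from))))
  where
  to : ∀ {y} → y ∈ map f (filter P? xs) → y ∈ filter Q? ys
  to y∈ with x , x∈ , refl ← ∈.∈-map⁻ f y∈ with x∈xs , Px ← ∈.∈-filter⁻ P? x∈
        with fx∈ys , Qfx ← f-maps x∈xs Px = ∈.∈-filter⁺ Q? fx∈ys Qfx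

  from : ∀ {y} → y ∈ filter Q? ys → y ∈ map f (filter P? xs)
  from y∈ with y∈ys , Qy ← ∈.∈-filter⁻ Q? y∈ with x , refl , x∈xs , Px ← f-onto y∈ys Qy =
    ∈.∈-map⁺ f (∈.∈-filter⁺ P? x∈xs Px)

∈-words : ∀ {k n} (w : Vec (Fin k) n) → w ∈ words k n
∈-words []      = here refl
∈-words (x ∷ w) = ∈.∈-cartesianProductWith⁺ _∷_ (∈.∈-allFin x) (∈-words w)

words-unique : ∀ k n → Unique (words k n)
words-unique k zero    = [] ∷ []
words-unique k (suc n) =
  Unique.cartesianProductWith⁺ _∷_ Vec.∷-injective (Unique.allFin⁺ k) (words-unique k n)

toList-injective : ∀ {n} {v w : Vec A n} → toList v ≡ toList w → v ≡ w
toList-injective {v = v} {w} eq = trans (sym (Vec.cast-is-id refl v)) (Vec.toList-injective refl v w eq)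

map-injective : ∀ {n} {f : A → B} → (∀ {x y} → f x ≡ f y → x ≡ y) →
                {v w : Vec A n} → Vec.map f v ≡ Vec.map f w → v ≡ w
map-injective f-injective {[]}    {[]}    _  = refl
map-injective f-injective {_ ∷ _} {_ ∷ _} eq =
  cong₂ _∷_ (f-injective (Vec.∷-injectiveˡ eq)) (map-injective f-injective (Vec.∷-injectiveʳ eq))

-- Chromatic symmetric functions

X-homogeneous : ∀ {n} (G : Graph n) → Homogeneous n (X G)
X-homogeneous {n} G α ∑α≢n = cong (λ xs → + length xs / 1)
  (List.filter-none _ (All.universal bad (words (length α) n)))
  where
  bad : ∀ κ → ¬ (Proper G κ × HasContent α (toList κ))
  bad κ (_ , eq) = ∑α≢n (trans (cong sum (sym eq)) (trans (sum-content (toList κ)) (Vec.length-toList κ)))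

-- Renaming colors by `embed` is a bijection between the proper colorings of content `α` and those
-- of content `β`: an injective renaming neither creates nor removes monochromatic edges.
X-quasisymmetric : ∀ {n} (G : Graph n) → Quasisymmetric (X G)
X-quasisymmetric {n} G {α} {β} α⊴β = cong (λ m → + m / 1)
  (length-filter-bijection _ _ (words-unique (length α) n) (words-unique (length β) n)
     (Vec.map f) (map-injective (embed-injective α⊴β)) maps onto)
  where
  f = embed α⊴β

  maps : ∀ {κ} → κ ∈ words (length α) n → Proper G κ × HasContent α (toList κ) →
         Vec.map f κ ∈ words (length β) n × Proper G (Vec.map f κ) × HasContent β (toList (Vec.map f κ))
  maps {κ} _ (proper , κα) = ∈-words _ ,
    (λ u v u~v eq → proper u v u~v (embed-injective α⊴β
      (trans (sym (Vec.lookup-map u f κ)) (trans eq (Vec.lookup-map v f κ))))) ,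
    subst (HasContent β) (sym (Vec.toList-map f κ)) (hasContent-embed⁺ α⊴β (toList κ) κα)

  preimage : ∀ {m} (κ : Vec _ m) → All (λ j → ∃ λ i → f i ≡ j) (toList κ) → ∃ λ κ′ → Vec.map f κ′ ≡ κ
  preimage []      []             = [] , refl
  preimage (_ ∷ κ) ((i , eq) ∷ is) with κ′ , eqs ← preimage κ is = i ∷ κ′ , cong₂ _∷_ eq eqs

  onto : ∀ {κ} → κ ∈ words (length β) n → Proper G κ × HasContent β (toList κ) →
         ∃ λ κ′ → Vec.map f κ′ ≡ κ × κ′ ∈ words (length α) n × Proper G κ′ × HasContent α (toList κ′)
  onto {κ} _ (proper , κβ) with κ′ , refl ← preimage κ (hasContent⇒embedded α⊴β (toList κ) κβ) =
    κ′ , refl , ∈-words κ′ ,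
    (λ u v u~v eq → proper u v u~v
      (trans (Vec.lookup-map u f κ′) (trans (cong f eq) (sym (Vec.lookup-map v f κ′))))) ,
    hasContent-embed⁻ α⊴β (toList κ′) (subst (HasContent β) (Vec.toList-map f κ′) κβ)

-- Schur functions

∈-fillings : ∀ {k} (T : List (List (Fin k))) → T ∈ fillings k (map length T)
∈-fillings []      = here refl
∈-fillings {k} (w ∷ T) = subst (λ w′ → w′ ∷ T ∈ fillings k (map length (w ∷ T))) (Vec.toList∘fromList w)
  (∈.∈-cartesianProductWith⁺ (λ w T → toList w ∷ T) (∈-words (Vec.fromList w)) (∈-fillings T))

fillings-shape : ∀ {k} p {T} → T ∈ fillings k p → map length T ≡ p
fillings-shape []      (here refl) = refl
fillings-shape {k} (r ∷ p) T∈
  with w , _ , _ , T∈′ , refl ← ∈.∈-cartesianProductWith⁻ _ (words k r) (fillings k p) T∈ =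
  cong₂ _∷_ (Vec.length-toList w) (fillings-shape p T∈′)

fillings-unique : ∀ k p → Unique (fillings k p)
fillings-unique k []      = [] ∷ []
fillings-unique k (r ∷ p) = Unique.cartesianProductWith⁺ _
  (λ eq → toList-injective (List.∷-injectiveˡ eq) , List.∷-injectiveʳ eq)
  (words-unique k r) (fillings-unique k p)

length-concat : ∀ (xss : List (List A)) → length (concat xss) ≡ sum (map length xss)
length-concat []         = refl
length-concat (xs ∷ xss) = trans (List.length-++ xs) (cong (length xs ℕ.+_) (length-concat xss))

semistandard-map⁺ : ∀ {k l} {f : Fin k → Fin l} → (∀ {i j} → i Fin.≤ j → f i Fin.≤ f j) →
  (∀ {i j} → i Fin.< j → f i Fin.< f j) → ∀ {T} → Semistandard T → Semistandard (map (map f) T)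
semistandard-map⁺ mono-≤ mono-< (rows , columns) =
  All.map⁺ (All.map (Linked.map⁺ ∘ Linked.map mono-≤) rows) ,
  Linked.map⁺ (Linked.map (Prefix.map⁺ _ _ ∘ Prefix.map mono-<) columns)

semistandard-map⁻ : ∀ {k l} {f : Fin k → Fin l} → (∀ {i j} → f i Fin.≤ f j → i Fin.≤ j) →
  (∀ {i j} → f i Fin.< f j → i Fin.< j) → ∀ {T} → Semistandard (map (map f) T) → Semistandard T
semistandard-map⁻ cancel-≤ cancel-< (rows , columns) =
  All.map (Linked.map cancel-≤ ∘ Linked.map⁻) (All.map⁻ rows) ,
  Linked.map (Prefix.map cancel-< ∘ Prefix.map⁻ _ _) (Linked.map⁻ columns)

s-homogeneous : ∀ p → Homogeneous (sum p) (s p)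
s-homogeneous p α ∑α≢∑p = cong (λ xs → + length xs / 1) (List.filter-none _ (All.tabulate bad))
  where
  bad : ∀ {T} → T ∈ fillings (length α) p → ¬ (Semistandard T × HasContent α (concat T))
  bad {T} T∈ (_ , eq) = ∑α≢∑p (begin
    sum α                    ≡⟨ cong sum eq ⟨
    sum (content (concat T)) ≡⟨ sum-content (concat T) ⟩
    length (concat T)        ≡⟨ length-concat T ⟩
    sum (map length T)       ≡⟨ cong sum (fillings-shape p T∈) ⟩
    sum p                    ∎)
    where open ≡-Reasoning

-- As for colorings, with `embed` applied to every entry. Here the renaming has to respect the order
-- in both directions, since semistandardness is a condition on the order.
s-quasisymmetric : ∀ p → Quasisymmetric (s p)
s-quasisymmetric p {α} {β} α⊴β = cong (λ m → + m / 1)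
  (length-filter-bijection _ _ (fillings-unique (length α) p) (fillings-unique (length β) p)
     (map (map f)) (List.map-injective (List.map-injective (embed-injective α⊴β))) maps onto)
  where
  f = embed α⊴β

  shape : ∀ T → map length (map (map f) T) ≡ map length T
  shape T = trans (sym (List.map-∘ T)) (List.map-cong (List.length-map f) T)

  maps : ∀ {T} → T ∈ fillings (length α) p → Semistandard T × HasContent α (concat T) →
         map (map f) T ∈ fillings (length β) p ×
         Semistandard (map (map f) T) × HasContent β (concat (map (map f) T))
  maps {T} T∈ (sst , Tα) =
    subst (λ q → map (map f) T ∈ fillings (length β) q) (trans (shape T) (fillings-shape p T∈)) (∈-fillings _) ,
    semistandard-map⁺ (embed-mono-≤ α⊴β) (embed-mono-< α⊴β) sst ,
    subst (HasContent β) (sym (List.concat-map T)) (hasContent-embed⁺ α⊴β (concat T) Tα)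

  preimage : ∀ {w} → All (λ j → ∃ λ i → f i ≡ j) w → ∃ λ w′ → map f w′ ≡ w
  preimage []              = [] , refl
  preimage ((i , eq) ∷ is) with w′ , eqs ← preimage is = i ∷ w′ , cong₂ _∷_ eq eqs

  preimages : ∀ {T} → All (All (λ j → ∃ λ i → f i ≡ j)) T → ∃ λ T′ → map (map f) T′ ≡ T
  preimages []         = [] , refl
  preimages (is ∷ iss) with w , eq ← preimage is with T , eqs ← preimages iss = w ∷ T , cong₂ _∷_ eq eqs

  onto : ∀ {T} → T ∈ fillings (length β) p → Semistandard T × HasContent β (concat T) →
         ∃ λ T′ → map (map f) T′ ≡ T × T′ ∈ fillings (length α) p ×
                  Semistandard T′ × HasContent α (concat T′)
  onto {T} T∈ (sst , Tβ) with T′ , refl ← preimages {T} (All.concat⁻ (hasContent⇒embedded α⊴β (concat T) Tβ)) =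
    T′ , refl ,
    subst (λ q → T′ ∈ fillings (length α) q) (trans (sym (shape T′)) (fillings-shape p T∈)) (∈-fillings T′) ,
    semistandard-map⁻ (embed-cancel-≤ α⊴β) (embed-cancel-< α⊴β) sst ,
    hasContent-embed⁻ α⊴β (concat T′) (subst (HasContent β) (List.concat-map T′) Tβ)

s-gradedQuasisymmetric : GradedQuasisymmetric s
s-gradedQuasisymmetric .homogeneous    = s-homogeneous
s-gradedQuasisymmetric .quasisymmetric = s-quasisymmetric

-- Coefficients in a basis

infix 8 ⟨_,_⟩

⟨_,_⟩ : List (ℚ × Monomial) → Series → ℚ
⟨ ws , F ⟩ = ∑[ ws ] λ (w , α) → w * F α

⟨⟩-linear : ∀ ws F q F′ → ⟨ ws , F ⊖ q · F′ ⟩ ≡ ⟨ ws , F ⟩ - q * ⟨ ws , F′ ⟩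
⟨⟩-linear ws F q F′ = trans
  (∑-cong ws λ (w , α) → solve 4 (λ w a q b → w :* (a :- q :* b) := w :* a :- q :* (w :* b))
                           refl w (F α) q (F′ α))
  (∑-linear q (λ (w , α) → w * F α) (λ (w , α) → w * F′ α) ws)
  where open ℚ.+-*-Solver

-- The first two conditions make exactly one indicator in the list equal to 1. All three form one
-- decidable proposition, which evaluation can check.
Dual : Family → ℕ → List ℕ → List (ℚ × Monomial) → Set
Dual b n q ws = Unique (partitions n) × q ∈ partitions n ×
                All (λ p → ⟨ ws , b p ⟩ ≡ indicator (p ≟ᵖ q)) (partitions n)

dual? : ∀ b n q ws → Dec (Dual b n q ws)
dual? b n q ws = DecUnique.unique? _≟ᵖ_ (partitions n) ×-dec DecMembership._∈?_ _≟ᵖ_ q (partitions n) ×-dec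
                 all? (λ p → ⟨ ws , b p ⟩ ℚ.≟ indicator (p ≟ᵖ q)) (partitions n)

-- Applying the functional to the expansion and exchanging the sums leaves only the term of `q`. As
-- this holds for every expansion, it pins down the existentially quantified coefficients in
-- `Coefficient` and `Positive` without a proof that the family is a basis.
dual-coefficient : ∀ b n q ws F c → Dual b n q ws → Expansion b n F c → c q ≡ ⟨ ws , F ⟩
dual-coefficient b n q ws F c (ps! , q∈ps , dual) expansion = sym (begin
  ∑[ ws ] (λ (w , α) → w * F α)
    ≡⟨ ∑-cong ws (λ (w , α) → cong (w *_) (expansion α)) ⟩
  ∑[ ws ] (λ (w , α) → w * ∑[ ps ] (λ p → c p * b p α))
    ≡⟨ ∑-cong ws (λ (w , α) → ∑-distribˡ w (λ p → c p * b p α) ps) ⟩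
  ∑[ ws ] (λ (w , α) → ∑[ ps ] (λ p → w * (c p * b p α)))
    ≡⟨ ∑-swap (λ (w , α) p → w * (c p * b p α)) ws ps ⟩
  ∑[ ps ] (λ p → ∑[ ws ] (λ (w , α) → w * (c p * b p α)))
    ≡⟨ ∑-cong ps (λ p → trans (∑-cong ws λ (w , α) → exchange w (c p) (b p α))
                               (sym (∑-distribˡ (c p) (λ (w , α) → w * b p α) ws))) ⟩
  ∑[ ps ] (λ p → c p * ⟨ ws , b p ⟩)
    ≡⟨ ∑-cong-All (All.map (λ {p} → cong (c p *_)) dual) ⟩
  ∑[ ps ] (λ p → c p * indicator (p ≟ᵖ q))
    ≡⟨ ∑-indicator c ps! q∈ps ⟩
  c q ∎)
  where
  open ≡-Reasoning
  ps = partitions n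

  exchange : ∀ x y z → x * (y * z) ≡ y * (x * z)
  exchange = solve 3 (λ x y z → x :* (y :* z) := y :* (x :* z)) refl
    where open ℚ.+-*-Solver

expansion-⊖ : ∀ b n F F′ c d q → Expansion b n F c → Expansion b n F′ d →
              Expansion b n (F ⊖ q · F′) (λ p → c p - q * d p)
expansion-⊖ b n F F′ c d q F-exp F′-exp α = begin
  F α - q * F′ α
    ≡⟨ cong₂ (λ x y → x - q * y) (F-exp α) (F′-exp α) ⟩
  ∑[ ps ] (λ p → c p * b p α) - q * ∑[ ps ] (λ p → d p * b p α)
    ≡⟨ ∑-linear q (λ p → c p * b p α) (λ p → d p * b p α) ps ⟨
  ∑[ ps ] (λ p → c p * b p α - q * (d p * b p α))
    ≡⟨ ∑-cong ps (λ p → solve 4 (λ x q y z → x :* z :- q :* (y :* z) := (x :- q :* y) :* z) refl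
                          (c p) q (d p) (b p α)) ⟩
  ∑[ ps ] (λ p → (c p - q * d p) * b p α) ∎
  where
  open ≡-Reasoning
  open ℚ.+-*-Solver
  ps = partitions n

dominates : ∀ b {n} p (G H : Graph n) c d → p ∈ partitions n →
  Expansion b n (X G) c → Expansion b n (X H) d → (dp≢0 : NonZero (d p)) →
  All (λ q → 0ℚ ≤ c q - _÷_ (c p) (d p) {{dp≢0}} * d q) (partitions n) → Dominates b p G H
dominates b {n} p G H c d p∈ G-exp H-exp dp≢0 nonneg =
  c p , d p , (p∈ , c , G-exp , refl) , (p∈ , d , H-exp , refl) , dp≢0 ,
  _ , expansion-⊖ b n (X G) (X H) c d (_÷_ (c p) (d p) {{dp≢0}}) G-exp H-exp , nonneg

-- Domination hands over unknown expansions. The functional `ws` identifies the ratio, and `vs`,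
-- being linear, identifies the coefficient of `b q` in the difference.
dominates⇒coefficient-nonneg : ∀ {b n p q ws vs x y u v} {G H : Graph n} →
  Dual b n p ws → Dual b n q vs →
  ⟨ ws , X G ⟩ ≡ x → ⟨ ws , X H ⟩ ≡ y → ⟨ vs , X G ⟩ ≡ u → ⟨ vs , X H ⟩ ≡ v →
  Dominates b p G H → Σ[ y≢0 ∈ NonZero y ] 0ℚ ≤ u - _÷_ x y {{y≢0}} * v
dominates⇒coefficient-nonneg {b} {n} {p} {q} {ws} {vs} {x} {y} {u} {v} {G} {H} p-dual q-dual ≡x ≡y ≡u ≡v
  (x′ , y′ , (_ , c , G-exp , ≡x′) , (_ , d , H-exp , ≡y′) , y′≢0 , f , G-H-exp , nonneg) =
  replace (trans (sym ≡x′) (trans (dual-coefficient b n p ws (X G) c p-dual G-exp) ≡x))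
          (trans (sym ≡y′) (trans (dual-coefficient b n p ws (X H) d p-dual H-exp) ≡y))
          y′≢0
          (trans (dual-coefficient b n q vs (X G ⊖ _÷_ x′ y′ {{y′≢0}} · X H) f q-dual G-H-exp)
             (trans (⟨⟩-linear vs (X G) (_÷_ x′ y′ {{y′≢0}}) (X H))
                    (cong₂ (λ u v → u - _÷_ x′ y′ {{y′≢0}} * v) ≡u ≡v)))
          (All.lookup nonneg (proj₁ (proj₂ q-dual)))
  where
  -- Division depends on the proof that the denominator is nonzero, so this proof is an argument
  -- here and is carried from `y′` to `y` by matching.
  replace : ∀ {z} → x′ ≡ x → y′ ≡ y → (y′≢0 : NonZero y′) → z ≡ u - _÷_ x′ y′ {{y′≢0}} * v → 0ℚ ≤ z →
            Σ[ y≢0 ∈ NonZero y ] 0ℚ ≤ u - _÷_ x y {{y≢0}} * v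
  replace refl refl y≢0 refl 0≤z = y≢0 , 0≤z

-- The implicit argument is the finite comparison at the compositions of `n`. Once the decision
-- evaluates to yes, its type is the unit type and it is filled in automatically.
X-expansion : ∀ b {n} (G : Graph n) c → GradedQuasisymmetric b →
  {True (all? (λ α → X G α ℚ.≟ ∑[ partitions n ] λ p → c p * b p α) (compositions n))} →
  Expansion b n (X G) c
X-expansion b {n} G c b-gqs {checked} =
  expansion-from-compositions b n (X G) c b-gqs (X-homogeneous G) (X-quasisymmetric G) (toWitness checked)

-- The four graphs

fromMatrix : ∀ {n} (M : Vec (Vec Bool n) n) → let at = λ u v → Vec.lookup (Vec.lookup M u) v in
  {True (Fin.all? λ u → Fin.all? λ v → T? (at u v) →-dec T? (at v u))} →
  {True (Fin.all? λ u → ¬? (T? (at u u)))} → Graph n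
fromMatrix M .Adj u v = T (Vec.lookup (Vec.lookup M u) v)
fromMatrix M .adj? u v = T? (Vec.lookup (Vec.lookup M u) v)
fromMatrix M {symmetric} .symm = toWitness symmetric _ _
fromMatrix M {_} {loopless} .irrefl refl = toWitness loopless _

-- Vertex 0 reaches every vertex along the path 0, 1, 2, and so on; reversing one such walk and
-- appending another joins any two vertices. The matrices below number the vertices along a
-- Hamiltonian path.
hamiltonian⇒connected : ∀ {n} (G : Graph (suc n)) → (∀ i → Adj G (inject₁ i) (suc i)) → Connected G
hamiltonian⇒connected G step = _ , λ u v → Star.reverse (symm G) (from-zero u) ◅◅ from-zero v
  where
  from-zero : ∀ v → Star (Adj G) zero v
  from-zero = Fin.<-weakInduction (Star (Adj G) zero) ε (λ i path → path ◅◅ step i ◅ ε)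

pattern ∙ = false
pattern ■ = true

-- The house is the 5-cycle 0, 1, 2, 3, 4 with the chord from 1 to 4; the bowtie consists of the
-- triangles 0, 1, 2 and 2, 3, 4.
house bowtie : Graph 5
house = fromMatrix
  ( (∙ ∷ ■ ∷ ∙ ∷ ∙ ∷ ■ ∷ [])
  ∷ (■ ∷ ∙ ∷ ■ ∷ ∙ ∷ ■ ∷ [])
  ∷ (∙ ∷ ■ ∷ ∙ ∷ ■ ∷ ∙ ∷ [])
  ∷ (∙ ∷ ∙ ∷ ■ ∷ ∙ ∷ ■ ∷ [])
  ∷ (■ ∷ ■ ∷ ∙ ∷ ■ ∷ ∙ ∷ [])
  ∷ [])
bowtie = fromMatrix
  ( (∙ ∷ ■ ∷ ■ ∷ ∙ ∷ ∙ ∷ [])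
  ∷ (■ ∷ ∙ ∷ ■ ∷ ∙ ∷ ∙ ∷ [])
  ∷ (■ ∷ ■ ∷ ∙ ∷ ■ ∷ ■ ∷ [])
  ∷ (∙ ∷ ∙ ∷ ■ ∷ ∙ ∷ ■ ∷ [])
  ∷ (∙ ∷ ∙ ∷ ■ ∷ ■ ∷ ∙ ∷ [])
  ∷ [])

-- The diamond is the 4-cycle 0, 1, 2, 3 with the chord from 0 to 2.
square diamond : Graph 4
square = fromMatrix
  ( (∙ ∷ ■ ∷ ∙ ∷ ■ ∷ [])
  ∷ (■ ∷ ∙ ∷ ■ ∷ ∙ ∷ [])
  ∷ (∙ ∷ ■ ∷ ∙ ∷ ■ ∷ [])
  ∷ (■ ∷ ∙ ∷ ■ ∷ ∙ ∷ [])
  ∷ [])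
diamond = fromMatrix
  ( (∙ ∷ ■ ∷ ■ ∷ ■ ∷ [])
  ∷ (■ ∷ ∙ ∷ ■ ∷ ∙ ∷ [])
  ∷ (■ ∷ ■ ∷ ∙ ∷ ■ ∷ [])
  ∷ (■ ∷ ∙ ∷ ■ ∷ ∙ ∷ [])
  ∷ [])

house-connected : Connected house
house-connected = hamiltonian⇒connected house (from-yes (Fin.all? λ i → adj? house (inject₁ i) (suc i)))

bowtie-connected : Connected bowtie
bowtie-connected = hamiltonian⇒connected bowtie (from-yes (Fin.all? λ i → adj? bowtie (inject₁ i) (suc i)))

square-connected : Connected square
square-connected = hamiltonian⇒connected square (from-yes (Fin.all? λ i → adj? square (inject₁ i) (suc i)))

diamond-connected : Connected diamond
diamond-connected = hamiltonian⇒connected diamond (from-yes (Fin.all? λ i → adj? diamond (inject₁ i) (suc i)))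

-- Expansions and comparisons of the four graphs

-- Full expansions are recorded only in the basis where domination holds. Each refutation in the
-- other basis takes just two coefficients per graph, read off by dual functionals.
house-e bowtie-e square-s diamond-s : List ℕ → ℚ
house-e (5 ∷ [])     = + 30 / 1
house-e (4 ∷ 1 ∷ []) = + 6 / 1
house-e (3 ∷ 2 ∷ []) = + 6 / 1
house-e _            = 0ℚ
bowtie-e (5 ∷ [])     = + 20 / 1
bowtie-e (4 ∷ 1 ∷ []) = + 12 / 1
bowtie-e (3 ∷ 2 ∷ []) = + 4 / 1
bowtie-e _            = 0ℚ
square-s (2 ∷ 2 ∷ [])         = + 2 / 1
square-s (2 ∷ 1 ∷ 1 ∷ [])     = + 2 / 1
square-s (1 ∷ 1 ∷ 1 ∷ 1 ∷ []) = + 14 / 1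
square-s _                    = 0ℚ
diamond-s (2 ∷ 1 ∷ 1 ∷ [])     = + 2 / 1
diamond-s (1 ∷ 1 ∷ 1 ∷ 1 ∷ []) = + 18 / 1
diamond-s _                    = 0ℚ

house-e-expansion : Expansion e 5 (X house) house-e
house-e-expansion = X-expansion e house house-e e-gradedQuasisymmetric

bowtie-e-expansion : Expansion e 5 (X bowtie) bowtie-e
bowtie-e-expansion = X-expansion e bowtie bowtie-e e-gradedQuasisymmetric

square-s-expansion : Expansion s 4 (X square) square-s
square-s-expansion = X-expansion s square square-s s-gradedQuasisymmetric

diamond-s-expansion : Expansion s 4 (X diamond) diamond-s
diamond-s-expansion = X-expansion s diamond diamond-s s-gradedQuasisymmetric

-- The ratio is 20/30, and the difference is 8 e₄₁: the terms in e₅ and e₃₂ cancel.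
bowtie≥ₑhouse : bowtie ≥ₑ house
bowtie≥ₑhouse = dominates e (5 ∷ []) bowtie house bowtie-e house-e
  (from-yes (DecMembership._∈?_ _≟ᵖ_ (5 ∷ []) (partitions 5))) bowtie-e-expansion house-e-expansion _
  (from-yes (all? (λ q → 0ℚ ℚ.≤? bowtie-e q - (+ 20 / 1) ÷ (+ 30 / 1) * house-e q) (partitions 5)))

-- The ratio is 14/18, and the difference is 2 s₂₂ + (4/9) s₂₁₁.
square≥ₛdiamond : square ≥ₛ diamond
square≥ₛdiamond = dominates s (1 ∷ 1 ∷ 1 ∷ 1 ∷ []) square diamond square-s diamond-s
  (from-yes (DecMembership._∈?_ _≟ᵖ_ (1 ∷ 1 ∷ 1 ∷ 1 ∷ []) (partitions 4))) square-s-expansion diamond-s-expansion _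
  (from-yes (all? (λ q → 0ℚ ℚ.≤? square-s q - (+ 14 / 1) ÷ (+ 18 / 1) * diamond-s q) (partitions 4)))

-- The house has 6 proper colorings with color classes of sizes 2, 2, 1 in this order, the bowtie
-- only 4.
X-house≉X-bowtie : ¬ (X house ≈ X bowtie)
X-house≉X-bowtie eq = from-no (X house (2 ∷ 2 ∷ 1 ∷ []) ℚ.≟ X bowtie (2 ∷ 2 ∷ 1 ∷ [])) (eq (2 ∷ 2 ∷ 1 ∷ []))

-- The diamond contains a triangle and has no proper coloring with two colors; the square has two
-- with both classes of size 2.
X-diamond≉X-square : ¬ (X diamond ≈ X square)
X-diamond≉X-square eq = from-no (X diamond (2 ∷ 2 ∷ []) ℚ.≟ X square (2 ∷ 2 ∷ [])) (eq (2 ∷ 2 ∷ []))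

-- The weights are rows of the inverse of the matrix of coefficients [x^α] b_p indexed by
-- partitions p and α (the Kostka matrix for b = s).

s₁₁₁₁₁* s₂₂₁* e₄* e₃₁* : List (ℚ × Monomial)
s₁₁₁₁₁* = (+ 1 / 1 , 5 ∷ [])
        ∷ (- (+ 2 / 1) , 4 ∷ 1 ∷ [])
        ∷ (- (+ 2 / 1) , 3 ∷ 2 ∷ [])
        ∷ (+ 3 / 1 , 3 ∷ 1 ∷ 1 ∷ [])
        ∷ (+ 3 / 1 , 2 ∷ 2 ∷ 1 ∷ [])
        ∷ (- (+ 4 / 1) , 2 ∷ 1 ∷ 1 ∷ 1 ∷ [])
        ∷ (+ 1 / 1 , 1 ∷ 1 ∷ 1 ∷ 1 ∷ 1 ∷ [])
        ∷ []
s₂₂₁* = (+ 1 / 1 , 4 ∷ 1 ∷ [])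
      ∷ (- (+ 1 / 1) , 3 ∷ 2 ∷ [])
      ∷ (- (+ 1 / 1) , 3 ∷ 1 ∷ 1 ∷ [])
      ∷ (+ 1 / 1 , 2 ∷ 2 ∷ 1 ∷ [])
      ∷ []
e₄* = (- (+ 4 / 1) , 4 ∷ [])
    ∷ (+ 4 / 1 , 3 ∷ 1 ∷ [])
    ∷ (+ 2 / 1 , 2 ∷ 2 ∷ [])
    ∷ (- (+ 4 / 1) , 2 ∷ 1 ∷ 1 ∷ [])
    ∷ (+ 1 / 1 , 1 ∷ 1 ∷ 1 ∷ 1 ∷ [])
    ∷ []
e₃₁* = (+ 4 / 1 , 4 ∷ [])
     ∷ (- (+ 1 / 1) , 3 ∷ 1 ∷ [])
     ∷ (- (+ 2 / 1) , 2 ∷ 2 ∷ [])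
     ∷ (+ 1 / 1 , 2 ∷ 1 ∷ 1 ∷ [])
     ∷ []

s₁₁₁₁₁*-dual : Dual s 5 (1 ∷ 1 ∷ 1 ∷ 1 ∷ 1 ∷ []) s₁₁₁₁₁*
s₁₁₁₁₁*-dual = from-yes (dual? s 5 (1 ∷ 1 ∷ 1 ∷ 1 ∷ 1 ∷ []) s₁₁₁₁₁*)

s₂₂₁*-dual : Dual s 5 (2 ∷ 2 ∷ 1 ∷ []) s₂₂₁*
s₂₂₁*-dual = from-yes (dual? s 5 (2 ∷ 2 ∷ 1 ∷ []) s₂₂₁*)

e₄*-dual : Dual e 4 (4 ∷ []) e₄*
e₄*-dual = from-yes (dual? e 4 (4 ∷ []) e₄*)

e₃₁*-dual : Dual e 4 (3 ∷ 1 ∷ []) e₃₁*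
e₃₁*-dual = from-yes (dual? e 4 (3 ∷ 1 ∷ []) e₃₁*)

s₁₁₁₁₁-bowtie : ⟨ s₁₁₁₁₁* , X bowtie ⟩ ≡ + 36 / 1
s₁₁₁₁₁-bowtie = refl

s₁₁₁₁₁-house : ⟨ s₁₁₁₁₁* , X house ⟩ ≡ + 42 / 1
s₁₁₁₁₁-house = refl

s₂₂₁-bowtie : ⟨ s₂₂₁* , X bowtie ⟩ ≡ + 4 / 1
s₂₂₁-bowtie = refl

s₂₂₁-house : ⟨ s₂₂₁* , X house ⟩ ≡ + 6 / 1
s₂₂₁-house = refl

-- [s₂₂₁] (X bowtie − (36/42) X house) = 4 − (36/42) · 6 < 0
bowtie≱ₛhouse : ¬ (bowtie ≥ₛ house)
bowtie≱ₛhouse bowtie≥house = from-no (0ℚ ℚ.≤? (+ 4 / 1) - (+ 36 / 1) ÷ (+ 42 / 1) * (+ 6 / 1))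
  (proj₂ (dominates⇒coefficient-nonneg {s} {5} {1 ∷ 1 ∷ 1 ∷ 1 ∷ 1 ∷ []} {2 ∷ 2 ∷ 1 ∷ []} {s₁₁₁₁₁*} {s₂₂₁*} {x = + 36 / 1} {+ 42 / 1} {+ 4 / 1} {+ 6 / 1} {bowtie} {house} s₁₁₁₁₁*-dual s₂₂₁*-dual
            s₁₁₁₁₁-bowtie s₁₁₁₁₁-house s₂₂₁-bowtie s₂₂₁-house bowtie≥house))

-- [e₃₁] (X square − (12/16) X diamond) = 0 − (12/16) · 2 < 0
square≱ₑdiamond : ¬ (square ≥ₑ diamond)
square≱ₑdiamond square≥diamond = from-no (0ℚ ℚ.≤? 0ℚ - (+ 12 / 1) ÷ (+ 16 / 1) * (+ 2 / 1))
  (proj₂ (dominates⇒coefficient-nonneg {e} {4} {4 ∷ []} {3 ∷ 1 ∷ []} {e₄*} {e₃₁*} {x = + 12 / 1} {+ 16 / 1} {0ℚ} {+ 2 / 1} {square} {diamond} e₄*-dual e₃₁*-dual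
            refl refl refl refl square≥diamond))

proposition2p23 : (Σ[ n ∈ ℕ ] Σ[ G ∈ Graph n ] Σ[ H ∈ Graph n ]
    (Connected G × Connected H × G <ₑ H × ¬ (G <ₛ H)))
    ×
    (Σ[ n ∈ ℕ ] Σ[ G ∈ Graph n ] Σ[ H ∈ Graph n ]
    (Connected G × Connected H × G <ₛ H × ¬ (G <ₑ H)))
proposition2p23 =
  -- The chromatic symmetric functions differ in each pair, so what fails is domination, the first
  -- component of the strict relation.
  (5 , house , bowtie , house-connected , bowtie-connected ,
   (bowtie≥ₑhouse , X-house≉X-bowtie) , bowtie≱ₛhouse ∘ proj₁) ,
  (4 , diamond , square , diamond-connected , square-connected ,
   (square≥ₛdiamond , X-diamond≉X-square) , square≱ₑdiamond ∘ proj₁)
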